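{- For all positive integers $a,b,\mu\in\mathbb{N}^{+}$, the sequence $n\mapsto \bar{M}(K_n;a,b)$ is ultimately periodic modulo $\mu$, where $\bar M$ is the bivariate matching polynomial and $K_n$ is the complete graph on $n$ vertices.
   Context: For a finite simple graph $G$ with $n$ vertices, let $m_k(G)$ be the number of matchings of size $k$ in $G$ (sets of $k$ pairwise vertex-disjoint edges). The bivariate matching polynomial is $$\bar{M}(G;X,Y)=\sum_{k=0}^{\lfloor n/2\rfloor}m_k(G)\,X^k\,Y^{n-2k}.$$ An integer sequence $(s_n)_{n\ge 1}$ is ultimately periodic modulo $\mu$ if there exist $N\ge 1$ and $p\ge 1$ such that $s_{n+p}\equiv s_n \pmod{\mu}$ for all $n\ge N$. -}

module Defs where

open import Algebra.Bundles using (CommutativeRing)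
open import Data.Fin.Base as Fin using (Fin; toℕ)
import Data.Fin.Properties as Fin
open import Data.Integer.Base as ℤ using (ℤ; +_; _-_)
import Data.Integer.Divisibility as ℤ
import Data.Integer.Properties as ℤ
open import Data.List.Base using (List; []; _∷_; [_]; _++_; map; filter; length; allFin; cartesianProduct)
open import Data.List.Relation.Unary.AllPairs using (AllPairs; allPairs?)
open import Data.Nat.Base using (ℕ; zero; suc; _+_; _*_; _∸_; _≥_; ⌊_/2⌋)
open import Data.Product.Base using (∃₂; _×_; _,_)
open import Level using (0ℓ)
open import Relation.Binary.Core using (Rel)
open import Relation.Binary.Definitions using (Decidable; Symmetric)
open import Relation.Binary.PropositionalEquality using (_≢_; refl; sym)
open import Relation.Nullary using (¬_; Dec; ¬?; _×-dec_)

open import Algebra.Properties.Semiring.Sum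
  (CommutativeRing.semiring ℤ.+-*-commutativeRing)
  using (sum⁺-syntax)

record SimpleGraph (n : ℕ) : Set₁ where
  field
    Adj       : Rel (Fin n) 0ℓ
    adj?      : Decidable Adj
    symmetric : Symmetric Adj
    loopless  : ∀ v → ¬ Adj v v

open SimpleGraph public

K : ∀ n → SimpleGraph n
K n .Adj           = _≢_
K n .adj? u v      = ¬? (u Fin.≟ v)
K n .symmetric u≢v = λ v≡u → u≢v (sym v≡u)
K n .loopless v    = λ v≢v → v≢v refl

-- An undirected edge {u , v} is represented by the pair (u , v) with u < v,
-- so each edge has exactly one representative.
IsEdge : ∀ {n} → SimpleGraph n → Fin n × Fin n → Set
IsEdge G (u , v) = u Fin.< v × Adj G u v

isEdge? : ∀ {n} (G : SimpleGraph n) (e : Fin n × Fin n) → Dec (IsEdge G e)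
isEdge? G (u , v) = (u Fin.<? v) ×-dec adj? G u v

edges : ∀ {n} → SimpleGraph n → List (Fin n × Fin n)
edges {n} G = filter (isEdge? G) (cartesianProduct (allFin n) (allFin n))

Disjoint : ∀ {n} → Rel (Fin n × Fin n) 0ℓ
Disjoint (u , v) (x , y) = u ≢ x × u ≢ y × v ≢ x × v ≢ y

disjoint? : ∀ {n} → Decidable (Disjoint {n})
disjoint? (u , v) (x , y) =
  ¬? (u Fin.≟ x) ×-dec ¬? (u Fin.≟ y) ×-dec ¬? (v Fin.≟ x) ×-dec ¬? (v Fin.≟ y)

-- All sublists of length k.  Applied to a duplicate-free list, this
-- enumerates each k-element subset of its entries exactly once.
sublists : ∀ {A : Set} → ℕ → List A → List (List A)
sublists zero    _        = [ [] ]
sublists (suc k) []       = []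
sublists (suc k) (x ∷ xs) = map (x ∷_) (sublists k xs) ++ sublists (suc k) xs

matchings : ∀ {n} → ℕ → SimpleGraph n → List (List (Fin n × Fin n))
matchings k G = filter (allPairs? disjoint?) (sublists k (edges G))

m : ∀ {n} → ℕ → SimpleGraph n → ℕ
m k G = length (matchings k G)

-- The bivariate matching polynomial, as a polynomial function on ℤ.
M̄ : ∀ {n} → SimpleGraph n → ℤ → ℤ → ℤ
M̄ {n} G X Y =
  ∑[ k ≤ ⌊ n /2⌋ ]
    (+ m (toℕ k) G ℤ.* X ℤ.^ toℕ k ℤ.* Y ℤ.^ (n ∸ 2 * toℕ k))

_≡_[mod_] : ℤ → ℤ → ℕ → Set
x ≡ y [mod μ ] = (+ μ) ℤ.∣ (x - y)

-- A sequence (sₙ)ₙ≥₁ is given by a function on ℕ; since N ≥ 1, its value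
-- at 0 plays no role.
UltimatelyPeriodicMod : ℕ → (ℕ → ℤ) → Set
UltimatelyPeriodicMod μ s =
  ∃₂ λ N p → N ≥ 1 × p ≥ 1 × (∀ n → n ≥ N → s (n + p) ≡ s n [mod μ ])

{-# OPTIONS --safe #-}
-- Classifying the matchings of Kₙ₊₂ by the edge at vertex 0 gives
-- M̄(Kₙ₊₂) = Y M̄(Kₙ₊₁) + (n + 1) X M̄(Kₙ).  Modulo μ the triple
-- (n , M̄(Kₙ) , M̄(Kₙ₊₁)) therefore determines its successor; as it takes at most
-- μ³ values, two of them coincide and the sequence repeats from there on.
module Submission where

open import Defs
open import Algebra.Bundles using (CommutativeRing)
open import Data.Bool.Base using (true; false)
open import Data.Fin.Base as Fin using (Fin; zero; suc; toℕ; fromℕ<; punchIn; combine)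
import Data.Fin.Properties as Fin
open import Data.Integer.Base as ℤ using (ℤ; +_; _-_)
import Data.Integer.Divisibility.Signed as ℤ
import Data.Integer.DivMod as ℤ
import Data.Integer.Properties as ℤ
open import Data.Integer.Tactic.RingSolver using (solve-∀)
open import Data.List.Base using (List; []; _∷_; _++_; map; filter; length; allFin; cartesianProduct)
open import Data.List.Properties
open import Data.List.Relation.Unary.All as All using (all?; _∷_)
open import Data.List.Relation.Unary.AllPairs as AllPairs using (allPairs?; _∷_)
import Data.List.Relation.Unary.AllPairs.Properties as AllPairs
open import Data.Nat.Base using (ℕ; zero; suc; _+_; _*_; _∸_; _<_; _≤_; NonZero; ⌊_/2⌋; z≤n; s≤s; z<s; s<s; s<s⁻¹)
import Data.Nat.Properties as ℕ
open import Data.Product.Base as Product using (_×_; _,_; proj₁; proj₂; uncurry)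
open import Data.Sum.Base using (_⊎_; inj₁; inj₂)
open import Function.Base using (_∘_)
open import Level using (0ℓ)
open import Relation.Binary.Core using (Rel)
import Relation.Binary.Definitions as B
open import Relation.Binary.PropositionalEquality
open import Relation.Nullary using (Dec; yes; no; does; ¬?; _×-dec_)
open import Relation.Unary using (Pred; Decidable)
open import Relation.Unary.Properties using (_∩?_)

open import Algebra.Properties.Semiring.Sum
  (CommutativeRing.semiring ℤ.+-*-commutativeRing)
  using (sum; sum-cong-≗; *-distribˡ-sum; ∑-distrib-+)

open ≡-Reasoning

-- Filters of mapped lists, cartesian products and sublists.

private
  variable
    A C : Set

filter-map : {P : Pred C 0ℓ} (P? : Decidable P) (f : A → C) (xs : List A) →
             filter P? (map f xs) ≡ map f (filter (P? ∘ f) xs)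
filter-map P? f []       = refl
filter-map P? f (x ∷ xs) with does (P? (f x))
... | true  = cong (f x ∷_) (filter-map P? f xs)
... | false = filter-map P? f xs

filter-filter : {P Q : Pred A 0ℓ} (P? : Decidable P) (Q? : Decidable Q) (xs : List A) →
                filter Q? (filter P? xs) ≡ filter (P? ∩? Q?) xs
filter-filter P? Q? []       = refl
filter-filter P? Q? (x ∷ xs) with does (P? x)
... | false = filter-filter P? Q? xs
... | true with does (Q? x)
...   | true  = cong (x ∷_) (filter-filter P? Q? xs)
...   | false = filter-filter P? Q? xs

filter-comm : {P Q : Pred A 0ℓ} (P? : Decidable P) (Q? : Decidable Q) (xs : List A) →
              filter Q? (filter P? xs) ≡ filter P? (filter Q? xs)
filter-comm P? Q? xs = begin
  filter Q? (filter P? xs) ≡⟨ filter-filter P? Q? xs ⟩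
  filter (P? ∩? Q?) xs     ≡⟨ filter-≐ (P? ∩? Q?) (Q? ∩? P?) (Product.swap , Product.swap) xs ⟩
  filter (Q? ∩? P?) xs     ≡⟨ filter-filter Q? P? xs ⟨
  filter P? (filter Q? xs) ∎

-- The product is enumerated row by row: when `P x` holds, membership in the row of `x` is decided
-- by `Q` alone, and otherwise the whole row is rejected.
filter-cartesianProduct :
  {P : Pred A 0ℓ} {Q : Pred C 0ℓ} {R : Pred (A × C) 0ℓ}
  (P? : Decidable P) (Q? : Decidable Q) (R? : Decidable R) →
  (∀ {x y} → P x → Q y → R (x , y)) → (∀ {x y} → R (x , y) → P x × Q y) →
  ∀ xs ys → filter R? (cartesianProduct xs ys) ≡ cartesianProduct (filter P? xs) (filter Q? ys)
filter-cartesianProduct P? Q? R? R⁺ R⁻ []       ys = refl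
filter-cartesianProduct P? Q? R? R⁺ R⁻ (x ∷ xs) ys = begin
  filter R? (map (x ,_) ys ++ cartesianProduct xs ys)
    ≡⟨ filter-++ R? (map (x ,_) ys) (cartesianProduct xs ys) ⟩
  filter R? (map (x ,_) ys) ++ filter R? (cartesianProduct xs ys)
    ≡⟨ cong₂ _++_ (filter-map R? (x ,_) ys) (filter-cartesianProduct P? Q? R? R⁺ R⁻ xs ys) ⟩
  map (x ,_) (filter (R? ∘ (x ,_)) ys) ++ cartesianProduct (filter P? xs) (filter Q? ys)
    ≡⟨ step ⟩
  cartesianProduct (filter P? (x ∷ xs)) (filter Q? ys) ∎
  where
  step : map (x ,_) (filter (R? ∘ (x ,_)) ys) ++ cartesianProduct (filter P? xs) (filter Q? ys)
         ≡ cartesianProduct (filter P? (x ∷ xs)) (filter Q? ys)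
  step with P? x
  ... | yes Px = cong (λ zs → map (x ,_) zs ++ _)
                   (filter-≐ (R? ∘ (x ,_)) Q? (proj₂ ∘ R⁻ , R⁺ Px) ys)
  ... | no ¬Px = cong (λ zs → map (x ,_) zs ++ _)
                   (filter-none (R? ∘ (x ,_)) {xs = ys} (All.universal (λ _ → ¬Px ∘ proj₁ ∘ R⁻) ys))

map-cartesianProduct : (f : A → C) (xs ys : List A) →
  cartesianProduct (map f xs) (map f ys) ≡ map (Product.map f f) (cartesianProduct xs ys)
map-cartesianProduct f []       ys = refl
map-cartesianProduct f (x ∷ xs) ys = begin
  map (f x ,_) (map f ys) ++ cartesianProduct (map f xs) (map f ys)
    -- Both composites send `y` to `(f x , f y)` definitionally, so the maps over `ys` are fused and
    -- split again the other way.
    ≡⟨ cong₂ _++_ (trans (sym (map-∘ ys)) (map-∘ ys)) (map-cartesianProduct f xs ys) ⟩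
  map f² (map (x ,_) ys) ++ map f² (cartesianProduct xs ys)
    ≡⟨ map-++ f² (map (x ,_) ys) _ ⟨
  map f² (map (x ,_) ys ++ cartesianProduct xs ys) ∎
  where f² = Product.map f f

sublists-map : (f : A → C) → ∀ k xs → sublists k (map f xs) ≡ map (map f) (sublists k xs)
sublists-map f zero    xs       = refl
sublists-map f (suc k) []       = refl
sublists-map f (suc k) (x ∷ xs) = begin
  map (f x ∷_) (sublists k (map f xs)) ++ sublists (suc k) (map f xs)
    ≡⟨ cong₂ _++_ (cong (map (f x ∷_)) (sublists-map f k xs)) (sublists-map f (suc k) xs) ⟩
  map (f x ∷_) (map (map f) (sublists k xs)) ++ map (map f) (sublists (suc k) xs)
    ≡⟨ cong (_++ _) (trans (sym (map-∘ (sublists k xs))) (map-∘ (sublists k xs))) ⟩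
  map (map f) (map (x ∷_) (sublists k xs)) ++ map (map f) (sublists (suc k) xs)
    ≡⟨ map-++ (map f) (map (x ∷_) (sublists k xs)) _ ⟨
  map (map f) (map (x ∷_) (sublists k xs) ++ sublists (suc k) xs) ∎

-- If `P x` fails, every sublist starting with `x` is discarded; if it holds, only the tail of such
-- a sublist is still tested. In `count-∷` this turns a condition on the chosen entries into a
-- shorter list to choose from.
filter-all-sublists : {P : Pred A 0ℓ} (P? : Decidable P) → ∀ k xs →
                      filter (all? P?) (sublists k xs) ≡ sublists k (filter P? xs)
filter-all-sublists P? zero    xs       = refl
filter-all-sublists P? (suc k) []       = refl
filter-all-sublists P? (suc k) (x ∷ xs) = begin
  filter (all? P?) (map (x ∷_) (sublists k xs) ++ sublists (suc k) xs)
    ≡⟨ filter-++ (all? P?) (map (x ∷_) (sublists k xs)) (sublists (suc k) xs) ⟩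
  filter (all? P?) (map (x ∷_) (sublists k xs)) ++ filter (all? P?) (sublists (suc k) xs)
    ≡⟨ cong₂ _++_ (filter-map (all? P?) (x ∷_) (sublists k xs)) (filter-all-sublists P? (suc k) xs) ⟩
  map (x ∷_) (filter (all? P? ∘ (x ∷_)) (sublists k xs)) ++ sublists (suc k) (filter P? xs)
    ≡⟨ step (P? x) ⟩
  sublists (suc k) (filter P? (x ∷ xs)) ∎
  where
  step : Dec _ → map (x ∷_) (filter (all? P? ∘ (x ∷_)) (sublists k xs)) ++ sublists (suc k) (filter P? xs)
                 ≡ sublists (suc k) (filter P? (x ∷ xs))
  step (yes Px) = trans
    (cong (λ ls → map (x ∷_) ls ++ _) (trans
      (filter-≐ (all? P? ∘ (x ∷_)) (all? P?) (All.tail , (Px ∷_)) (sublists k xs))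
      (filter-all-sublists P? k xs)))
    (cong (sublists (suc k)) (sym (filter-accept P? Px)))
  step (no ¬Px) = trans
    (cong (λ ls → map (x ∷_) ls ++ _)
      (filter-none (all? P? ∘ (x ∷_)) {xs = sublists k xs}
        (All.universal (λ _ → ¬Px ∘ All.head) (sublists k xs))))
    (cong (sublists (suc k)) (sym (filter-reject P? ¬Px)))

-- Counting sublists with pairwise related entries.

module _ {R : Rel A 0ℓ} (R? : B.Decidable R) where

  -- `m k G` is definitionally `count disjoint? k (edges G)`. The general form admits arbitrary edge
  -- lists, as needed for removing edges one at a time.
  count : ℕ → List A → ℕ
  count k xs = length (filter (allPairs? R?) (sublists k xs))

  -- The choices are split by whether they contain the head `x`. If they do, the `k` remaining
  -- entries must all be related to `x`.
  count-∷ : ∀ k x xs → count (suc k) (x ∷ xs) ≡ count k (filter (R? x) xs) + count (suc k) xs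
  count-∷ k x xs = begin
    length (filter R?* (map (x ∷_) (sublists k xs) ++ sublists (suc k) xs))
      ≡⟨ cong length (filter-++ R?* (map (x ∷_) (sublists k xs)) (sublists (suc k) xs)) ⟩
    length (filter R?* (map (x ∷_) (sublists k xs)) ++ filter R?* (sublists (suc k) xs))
      ≡⟨ length-++ (filter R?* (map (x ∷_) (sublists k xs))) ⟩
    length (filter R?* (map (x ∷_) (sublists k xs))) + count (suc k) xs
      ≡⟨ cong (_+ count (suc k) xs) (begin
        length (filter R?* (map (x ∷_) (sublists k xs)))
          ≡⟨ cong length (filter-map R?* (x ∷_) (sublists k xs)) ⟩
        length (map (x ∷_) (filter (R?* ∘ (x ∷_)) (sublists k xs)))
          ≡⟨ length-map (x ∷_) (filter (R?* ∘ (x ∷_)) (sublists k xs)) ⟩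
        length (filter (R?* ∘ (x ∷_)) (sublists k xs))
          ≡⟨ cong length (filter-≐ (R?* ∘ (x ∷_)) (all? (R? x) ∩? R?*)
               (AllPairs.uncons , uncurry _∷_) (sublists k xs)) ⟩
        length (filter (all? (R? x) ∩? R?*) (sublists k xs))
          ≡⟨ cong length (filter-filter (all? (R? x)) R?* (sublists k xs)) ⟨
        length (filter R?* (filter (all? (R? x)) (sublists k xs)))
          ≡⟨ cong (length ∘ filter R?*) (filter-all-sublists (R? x) k xs) ⟩
        count k (filter (R? x) xs) ∎) ⟩
    count k (filter (R? x) xs) + count (suc k) xs ∎
    where R?* = allPairs? R?

count-map : {R : Rel A 0ℓ} {S : Rel C 0ℓ} (R? : B.Decidable R) (S? : B.Decidable S) (f : A → C) →
            (∀ {x y} → R x y → S (f x) (f y)) → (∀ {x y} → S (f x) (f y) → R x y) →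
            ∀ k xs → count S? k (map f xs) ≡ count R? k xs
count-map R? S? f R⇒S S⇒R k xs = begin
  length (filter (allPairs? S?) (sublists k (map f xs)))
    ≡⟨ cong (length ∘ filter (allPairs? S?)) (sublists-map f k xs) ⟩
  length (filter (allPairs? S?) (map (map f) (sublists k xs)))
    ≡⟨ cong length (filter-map (allPairs? S?) (map f) (sublists k xs)) ⟩
  length (map (map f) (filter (allPairs? S? ∘ map f) (sublists k xs)))
    ≡⟨ length-map (map f) (filter (allPairs? S? ∘ map f) (sublists k xs)) ⟩
  length (filter (allPairs? S? ∘ map f) (sublists k xs))
    ≡⟨ cong length (filter-≐ (allPairs? S? ∘ map f) (allPairs? R?)
         (AllPairs.map S⇒R ∘ AllPairs.map⁻ , AllPairs.map⁺ ∘ AllPairs.map R⇒S) (sublists k xs)) ⟩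
  length (filter (allPairs? R?) (sublists k xs)) ∎

-- Edge lists of complete graphs.

_² : (A → C) → A × A → C × C
f ² = Product.map f f

-- Disjointness from the edge joining 0 to `suc v` becomes this condition once the edges away from 0
-- are shifted down by one.
Avoids : ∀ {n} → Fin n → Pred (Fin n × Fin n) 0ℓ
Avoids v (x , y) = v ≢ x × v ≢ y

avoids? : ∀ {n} (v : Fin n) → Decidable (Avoids v)
avoids? v (x , y) = ¬? (v Fin.≟ x) ×-dec ¬? (v Fin.≟ y)

allFin-suc : ∀ n → allFin (suc n) ≡ zero ∷ map suc (allFin n)
allFin-suc n = cong (zero ∷_) (sym (map-tabulate (λ i → i) suc))

-- `punchIn v` is increasing and misses only `v`, so it runs through the other elements in the order
-- of `allFin`.
filter-≢-allFin : ∀ {n} (v : Fin (suc n)) →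
                  filter (λ x → ¬? (v Fin.≟ x)) (allFin (suc n)) ≡ map (punchIn v) (allFin n)
filter-≢-allFin {n} zero = begin
  filter (λ x → ¬? (zero Fin.≟ x)) (allFin (suc n))
    ≡⟨ cong (filter (λ x → ¬? (zero Fin.≟ x))) (allFin-suc n) ⟩
  -- The head `zero` has been rejected by evaluation.
  filter (λ x → ¬? (zero Fin.≟ x)) (map suc (allFin n))
    ≡⟨ filter-map (λ x → ¬? (zero Fin.≟ x)) suc (allFin n) ⟩
  map suc (filter (λ x → ¬? (zero Fin.≟ suc x)) (allFin n))
    ≡⟨ cong (map suc) (filter-all (λ x → ¬? (zero Fin.≟ suc x)) (All.universal (λ _ ()) (allFin n))) ⟩
  map suc (allFin n) ∎
filter-≢-allFin {suc n} (suc v) = begin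
  filter (λ x → ¬? (suc v Fin.≟ x)) (allFin (2 + n))
    ≡⟨ cong (filter (λ x → ¬? (suc v Fin.≟ x))) (allFin-suc (suc n)) ⟩
  zero ∷ filter (λ x → ¬? (suc v Fin.≟ x)) (map suc (allFin (suc n)))
    ≡⟨ cong (zero ∷_) (filter-map (λ x → ¬? (suc v Fin.≟ x)) suc (allFin (suc n))) ⟩
  zero ∷ map suc (filter (λ x → ¬? (suc v Fin.≟ suc x)) (allFin (suc n)))
    ≡⟨ cong (λ xs → zero ∷ map suc xs) (filter-≐ (λ x → ¬? (suc v Fin.≟ suc x)) (λ x → ¬? (v Fin.≟ x))
         ((λ s≢s → s≢s ∘ cong suc) , (λ v≢x → v≢x ∘ Fin.suc-injective)) (allFin (suc n))) ⟩
  zero ∷ map suc (filter (λ x → ¬? (v Fin.≟ x)) (allFin (suc n)))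
    ≡⟨ cong (λ xs → zero ∷ map suc xs) (filter-≢-allFin v) ⟩
  zero ∷ map suc (map (punchIn v) (allFin n))
    -- `suc ∘ punchIn v` and `punchIn (suc v) ∘ suc` agree definitionally.
    ≡⟨ cong (zero ∷_) (trans (sym (map-∘ (allFin n))) (map-∘ (allFin n))) ⟩
  map (punchIn (suc v)) (zero ∷ map suc (allFin n))
    ≡⟨ cong (map (punchIn (suc v))) (allFin-suc n) ⟨
  map (punchIn (suc v)) (allFin (suc n)) ∎

punchIn-mono-< : ∀ {n} (v : Fin (suc n)) {x y : Fin n} → x Fin.< y → punchIn v x Fin.< punchIn v y
punchIn-mono-< v {x} {y} x<y = ℕ.≰⇒> (λ y≤x → ℕ.<⇒≱ x<y (Fin.punchIn-cancel-≤ v y x y≤x))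

punchIn-cancel-< : ∀ {n} (v : Fin (suc n)) {x y : Fin n} → punchIn v x Fin.< punchIn v y → x Fin.< y
punchIn-cancel-< v {x} {y} x<y = ℕ.≰⇒> (λ y≤x → ℕ.<⇒≱ x<y (Fin.punchIn-mono-≤ v y x y≤x))

isEdge-K : ∀ {n} {x y : Fin n} → x Fin.< y → IsEdge (K n) (x , y)
isEdge-K x<y = x<y , Fin.<⇒≢ x<y

-- Deleting `v` from Kₙ₊₁ leaves a copy of Kₙ. As `punchIn v` preserves and reflects `<`, it
-- respects the orientation of edges and the order of their enumeration, whence an equality of lists
-- and not only up to permutation.
edges-avoiding : ∀ {n} (v : Fin (suc n)) →
                 filter (avoids? v) (edges (K (suc n))) ≡ map (punchIn v ²) (edges (K n))
edges-avoiding {n} v = begin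
  filter (avoids? v) (filter edge? (cartesianProduct (allFin (suc n)) (allFin (suc n))))
    -- On the full product the vertex condition acts on each coordinate separately, so it is applied
    -- first.
    ≡⟨ filter-comm edge? (avoids? v) (cartesianProduct (allFin (suc n)) (allFin (suc n))) ⟩
  filter edge? (filter (avoids? v) (cartesianProduct (allFin (suc n)) (allFin (suc n))))
    ≡⟨ cong (filter edge?) (filter-cartesianProduct (λ x → ¬? (v Fin.≟ x)) (λ x → ¬? (v Fin.≟ x)) (avoids? v)
         _,_ (λ v≢ → v≢) (allFin (suc n)) (allFin (suc n))) ⟩
  filter edge? (cartesianProduct (filter (λ x → ¬? (v Fin.≟ x)) (allFin (suc n)))
                                 (filter (λ x → ¬? (v Fin.≟ x)) (allFin (suc n))))
    ≡⟨ cong (λ xs → filter edge? (cartesianProduct xs xs)) (filter-≢-allFin v) ⟩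
  filter edge? (cartesianProduct (map (punchIn v) (allFin n)) (map (punchIn v) (allFin n)))
    ≡⟨ cong (filter edge?) (map-cartesianProduct (punchIn v) (allFin n) (allFin n)) ⟩
  filter edge? (map (punchIn v ²) (cartesianProduct (allFin n) (allFin n)))
    ≡⟨ filter-map edge? (punchIn v ²) (cartesianProduct (allFin n) (allFin n)) ⟩
  map (punchIn v ²) (filter (edge? ∘ punchIn v ²) (cartesianProduct (allFin n) (allFin n)))
    ≡⟨ cong (map (punchIn v ²)) (filter-≐ (edge? ∘ punchIn v ²) (isEdge? (K n))
         ((λ e → isEdge-K (punchIn-cancel-< v (proj₁ e))) , (λ e → isEdge-K (punchIn-mono-< v (proj₁ e))))
         (cartesianProduct (allFin n) (allFin n))) ⟩
  map (punchIn v ²) (edges (K n)) ∎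
  where edge? = isEdge? (K (suc n))

star : ∀ {n} → Fin n → Fin (suc n) × Fin (suc n)
star v = zero , suc v

-- Pairs with first coordinate 0 are enumerated first, so the star at 0 is an initial segment, from
-- which `count-∷` can remove edges one by one.
edges-K-suc : ∀ n → edges (K (suc n)) ≡ map star (allFin n) ++ map (suc ²) (edges (K n))
edges-K-suc n = begin
  filter edge? (cartesianProduct (allFin (suc n)) (allFin (suc n)))
    ≡⟨ cong (λ xs → filter edge? (cartesianProduct xs xs)) (allFin-suc n) ⟩
  -- The head `(zero , zero)` is not increasing and has been rejected by evaluation.
  filter edge? (map (zero ,_) sucs ++ cartesianProduct sucs (zero ∷ sucs))
    ≡⟨ filter-++ edge? (map (zero ,_) sucs) (cartesianProduct sucs (zero ∷ sucs)) ⟩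
  filter edge? (map (zero ,_) sucs) ++ filter edge? (cartesianProduct sucs (zero ∷ sucs))
    ≡⟨ cong₂ _++_ at-zero (trans (off-zero (allFin n)) (begin
         filter edge? (cartesianProduct sucs sucs)
           ≡⟨ cong (filter edge?) (map-cartesianProduct suc (allFin n) (allFin n)) ⟩
         filter edge? (map (suc ²) (cartesianProduct (allFin n) (allFin n)))
           ≡⟨ filter-map edge? (suc ²) (cartesianProduct (allFin n) (allFin n)) ⟩
         map (suc ²) (filter (edge? ∘ suc ²) (cartesianProduct (allFin n) (allFin n)))
           ≡⟨ cong (map (suc ²)) (filter-≐ (edge? ∘ suc ²) (isEdge? (K n))
                ((λ e → isEdge-K (s<s⁻¹ (proj₁ e))) , (λ e → isEdge-K (s<s (proj₁ e))))
                (cartesianProduct (allFin n) (allFin n))) ⟩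
         map (suc ²) (edges (K n)) ∎)) ⟩
  map star (allFin n) ++ map (suc ²) (edges (K n)) ∎
  where
  edge? = isEdge? (K (suc n))
  sucs  = map suc (allFin n)

  at-zero : filter edge? (map (zero ,_) sucs) ≡ map star (allFin n)
  at-zero = begin
    filter edge? (map (zero ,_) sucs)
      ≡⟨ cong (filter edge?) (map-∘ (allFin n)) ⟨
    filter edge? (map star (allFin n))
      ≡⟨ filter-map edge? star (allFin n) ⟩
    map star (filter (edge? ∘ star) (allFin n))
      ≡⟨ cong (map star) (filter-all (edge? ∘ star) (All.universal (λ _ → isEdge-K z<s) (allFin n))) ⟩
    map star (allFin n) ∎

  -- No increasing pair ends in `zero`. The induction is over the rows, with the columns `sucs`
  -- fixed.
  off-zero : ∀ xs → filter edge? (cartesianProduct (map suc xs) (zero ∷ sucs))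
                    ≡ filter edge? (cartesianProduct (map suc xs) sucs)
  off-zero []       = refl
  off-zero (x ∷ xs) = begin
    filter edge? ((suc x , zero) ∷ row ++ cartesianProduct (map suc xs) (zero ∷ sucs))
      ≡⟨⟩
    filter edge? (row ++ cartesianProduct (map suc xs) (zero ∷ sucs))
      ≡⟨ filter-++ edge? row _ ⟩
    filter edge? row ++ filter edge? (cartesianProduct (map suc xs) (zero ∷ sucs))
      ≡⟨ cong (filter edge? row ++_) (off-zero xs) ⟩
    filter edge? row ++ filter edge? (cartesianProduct (map suc xs) sucs)
      ≡⟨ filter-++ edge? row _ ⟨
    filter edge? (row ++ cartesianProduct (map suc xs) sucs) ∎
    where row = map (suc x ,_) sucs

-- Matching numbers of complete graphs.

²-disjoint⁺ : ∀ {n n′} {f : Fin n → Fin n′} → (∀ {x y} → f x ≡ f y → x ≡ y) →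
              ∀ {d e} → Disjoint d e → Disjoint ((f ²) d) ((f ²) e)
²-disjoint⁺ inj (p , q , r , s) = p ∘ inj , q ∘ inj , r ∘ inj , s ∘ inj

²-disjoint⁻ : ∀ {n n′} {f : Fin n → Fin n′} {d e} → Disjoint ((f ²) d) ((f ²) e) → Disjoint d e
²-disjoint⁻ {f = f} (p , q , r , s) =
  p ∘ cong f , q ∘ cong f , r ∘ cong f , s ∘ cong f

count-² : ∀ {n n′} (f : Fin n → Fin n′) → (∀ {x y} → f x ≡ f y → x ≡ y) →
          ∀ k es → count disjoint? k (map (f ²) es) ≡ count disjoint? k es
count-² f inj = count-map disjoint? disjoint? (f ²) (²-disjoint⁺ inj) ²-disjoint⁻

-- Choosing `star v` excludes the other star edges, which share vertex 0, and leaves the shifted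
-- edges avoiding `v`, with `c` ways to continue. Summing over the star gives the product; the last
-- summand counts the choices with no star edge.
count-star : ∀ {n} k c (es : List (Fin n × Fin n)) →
             (∀ v → count disjoint? k (filter (avoids? v) es) ≡ c) → ∀ vs →
             count disjoint? (suc k) (map star vs ++ map (suc ²) es)
             ≡ length vs * c + count disjoint? (suc k) es
count-star k c es avoiding≡c []       = count-² suc Fin.suc-injective (suc k) es
count-star k c es avoiding≡c (v ∷ vs) = begin
  count disjoint? (suc k) (star v ∷ map star vs ++ map (suc ²) es)
    ≡⟨ count-∷ disjoint? k (star v) (map star vs ++ map (suc ²) es) ⟩
  count disjoint? k (filter (disjoint? (star v)) (map star vs ++ map (suc ²) es)) + _
    ≡⟨ cong₂ _+_ (trans (cong (count disjoint? k) remaining)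
         (trans (count-² suc Fin.suc-injective k _) (avoiding≡c v))) (count-star k c es avoiding≡c vs) ⟩
  c + (length vs * c + count disjoint? (suc k) es)
    ≡⟨ ℕ.+-assoc c _ _ ⟨
  length (v ∷ vs) * c + count disjoint? (suc k) es ∎
  where
  remaining : filter (disjoint? (star v)) (map star vs ++ map (suc ²) es)
              ≡ map (suc ²) (filter (avoids? v) es)
  remaining = begin
    filter (disjoint? (star v)) (map star vs ++ map (suc ²) es)
      ≡⟨ filter-++ (disjoint? (star v)) (map star vs) (map (suc ²) es) ⟩
    filter (disjoint? (star v)) (map star vs) ++ filter (disjoint? (star v)) (map (suc ²) es)
      ≡⟨ cong₂ _++_
           (trans (filter-map (disjoint? (star v)) star vs) (cong (map star)
             -- Two star edges agree in their first endpoint.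
             (filter-none (disjoint? (star v) ∘ star) (All.universal (λ _ d → proj₁ d refl) vs))))
           (filter-map (disjoint? (star v)) (suc ²) es) ⟩
    map (suc ²) (filter (disjoint? (star v) ∘ suc ²) es)
      ≡⟨ cong (map (suc ²)) (filter-≐ (disjoint? (star v) ∘ suc ²) (avoids? v)
           ( (λ { (_ , _ , v≢x , v≢y) → v≢x ∘ cong suc , v≢y ∘ cong suc })
           , (λ { (v≢x , v≢y) → (λ ()) , (λ ()) , v≢x ∘ Fin.suc-injective , v≢y ∘ Fin.suc-injective }))
           es) ⟩
    map (suc ²) (filter (avoids? v) es) ∎

-- Vertex 0 is either matched to one of the `suc n` others, and removing both ends leaves Kₙ, or it
-- stays uncovered, and the matching lies in Kₙ₊₁.
m-K-suc : ∀ n k → m (suc k) (K (2 + n)) ≡ suc n * m k (K n) + m (suc k) (K (suc n))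
m-K-suc n k = begin
  count disjoint? (suc k) (edges (K (2 + n)))
    ≡⟨ cong (count disjoint? (suc k)) (edges-K-suc (suc n)) ⟩
  count disjoint? (suc k) (map star (allFin (suc n)) ++ map (suc ²) (edges (K (suc n))))
    ≡⟨ count-star k (m k (K n)) (edges (K (suc n))) avoiding (allFin (suc n)) ⟩
  length (allFin (suc n)) * m k (K n) + m (suc k) (K (suc n))
    ≡⟨ cong (λ l → l * m k (K n) + m (suc k) (K (suc n))) (length-tabulate {n = suc n} (λ i → i)) ⟩
  suc n * m k (K n) + m (suc k) (K (suc n)) ∎
  where
  avoiding : ∀ v → count disjoint? k (filter (avoids? v) (edges (K (suc n)))) ≡ m k (K n)
  avoiding v = trans (cong (count disjoint? k) (edges-avoiding v))
                     (count-² (punchIn v) (Fin.punchIn-injective v _ _) k (edges (K n)))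

-- A matching of size `k` covers `2 * k` vertices; formally, both summands of `m-K-suc` vanish by
-- induction. This handles sums of unequal range and exponents cut off by `∸`.
m-K-vanishes : ∀ n k → n < 2 * k → m k (K n) ≡ 0
m-K-vanishes n             zero    ()
-- K₀ and K₁ have no edges, by evaluation.
m-K-vanishes zero          (suc k) _ = refl
m-K-vanishes (suc zero)    (suc k) _ = refl
m-K-vanishes (suc (suc n)) (suc k) n+2<2k+2 = begin
  m (suc k) (K (2 + n))
    ≡⟨ m-K-suc n k ⟩
  suc n * m k (K n) + m (suc k) (K (suc n))
    ≡⟨ cong₂ (λ c d → suc n * c + d) (m-K-vanishes n k n<2k)
         (m-K-vanishes (suc n) (suc k) (ℕ.<-trans ℕ.≤-refl n+2<2k+2)) ⟩
  suc n * 0 + 0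
    ≡⟨ ℕ.+-identityʳ (suc n * 0) ⟩
  suc n * 0
    ≡⟨ ℕ.*-zeroʳ (suc n) ⟩
  0 ∎
  where
  n<2k : n < 2 * k
  n<2k = s<s⁻¹ (s<s⁻¹ (subst (2 + n <_) (ℕ.*-suc 2 k) n+2<2k+2))


-- The recurrence for the matching polynomials.

sum-extend : (f : ℕ → ℤ) → ∀ n → f n ≡ ℤ.0ℤ → sum {suc n} (f ∘ toℕ) ≡ sum {n} (f ∘ toℕ)
sum-extend f zero    f0≡0 = trans (ℤ.+-identityʳ (f 0)) f0≡0
sum-extend f (suc n) fn≡0 = cong (λ z → f 0 ℤ.+ z) (sum-extend (f ∘ suc) n fn≡0)

-- The cases are `n` odd and `n` even. In the even case the bound makes size `suc ⌊ n /2⌋` too large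
-- for a matching of Kₙ₊₁.
⌊1+n/2⌋-cases : ∀ n → ⌊ suc n /2⌋ ≡ suc ⌊ n /2⌋ ⊎ (⌊ suc n /2⌋ ≡ ⌊ n /2⌋ × suc n < 2 * suc ⌊ n /2⌋)
⌊1+n/2⌋-cases zero          = inj₂ (refl , ℕ.≤-refl)
⌊1+n/2⌋-cases (suc zero)    = inj₁ refl
⌊1+n/2⌋-cases (suc (suc n)) with ⌊1+n/2⌋-cases n
... | inj₁ eq          = inj₁ (cong suc eq)
... | inj₂ (eq , n+1<) = inj₂ (cong suc eq ,
        subst (3 + n <_) (sym (ℕ.*-suc 2 (suc ⌊ n /2⌋))) (s<s (s<s n+1<)))

module _ (X Y : ℤ) where

  term : ℕ → ℕ → ℤ
  term n k = + m k (K n) ℤ.* X ℤ.^ k ℤ.* Y ℤ.^ (n ∸ 2 * k)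

  term-vanishes : ∀ n k → n < 2 * k → term n k ≡ ℤ.0ℤ
  term-vanishes n k n<2k rewrite m-K-vanishes n k n<2k = refl

  -- For even n this has one term too many, which vanishes; the range is then that of M̄(Kₙ₊₂).
  M̄-K-suc : ∀ n → M̄ (K (suc n)) X Y ≡ sum {2 + ⌊ n /2⌋} (term (suc n) ∘ toℕ)
  M̄-K-suc n with ⌊1+n/2⌋-cases n
  ... | inj₁ eq          rewrite eq = refl
  ... | inj₂ (eq , n+1<) rewrite eq =
    sym (sum-extend (term (suc n)) (suc ⌊ n /2⌋) (term-vanishes (suc n) (suc ⌊ n /2⌋) n+1<))

  term-0 : ∀ n → term (suc n) 0 ≡ Y ℤ.* term n 0
  term-0 n = identity Y (Y ℤ.^ n)
    where
    -- The factors `1ℤ` are the values of `m 0` and of `X ^ 0`.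
    identity : ∀ y z → ℤ.1ℤ ℤ.* ℤ.1ℤ ℤ.* (y ℤ.* z) ≡ y ℤ.* (ℤ.1ℤ ℤ.* ℤ.1ℤ ℤ.* z)
    identity = solve-∀

  -- The exponent in `term (suc n) (suc k)` is smaller by one, which the factor `Y` makes up for if
  -- `2 * k < n`. Otherwise truncation makes both exponents 0, but then `m (suc k) (K (suc n))` is
  -- 0.
  lower-power : ∀ n k → + m (suc k) (K (suc n)) ℤ.* X ℤ.^ suc k ℤ.* Y ℤ.^ (n ∸ 2 * k)
                        ≡ Y ℤ.* term (suc n) (suc k)
  lower-power n k with 2 * k ℕ.<? n
  lower-power (suc n) k | yes (s≤s 2k≤n) = begin
    c ℤ.* X ℤ.^ suc k ℤ.* Y ℤ.^ (suc n ∸ 2 * k)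
      ≡⟨ cong (λ e → c ℤ.* X ℤ.^ suc k ℤ.* Y ℤ.^ e) (ℕ.+-∸-assoc 1 2k≤n) ⟩
    c ℤ.* X ℤ.^ suc k ℤ.* (Y ℤ.* Y ℤ.^ (n ∸ 2 * k))
      ≡⟨ identity Y (c ℤ.* X ℤ.^ suc k) (Y ℤ.^ (n ∸ 2 * k)) ⟩
    Y ℤ.* (c ℤ.* X ℤ.^ suc k ℤ.* Y ℤ.^ (n ∸ 2 * k))
      ≡⟨ cong (λ e → Y ℤ.* (c ℤ.* X ℤ.^ suc k ℤ.* Y ℤ.^ e)) (cong (2 + n ∸_) (ℕ.*-suc 2 k)) ⟨
    Y ℤ.* term (2 + n) (suc k) ∎
    where
    c = + m (suc k) (K (2 + n))

    identity : ∀ y p q → p ℤ.* (y ℤ.* q) ≡ y ℤ.* (p ℤ.* q)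
    identity = solve-∀
  lower-power n k | no 2k≮n = begin
    + m (suc k) (K (suc n)) ℤ.* X ℤ.^ suc k ℤ.* Y ℤ.^ (n ∸ 2 * k)
      ≡⟨ cong (λ c → + c ℤ.* X ℤ.^ suc k ℤ.* Y ℤ.^ (n ∸ 2 * k)) (m-K-vanishes (suc n) (suc k) n+1<2k+2) ⟩
    ℤ.0ℤ
      ≡⟨ ℤ.*-zeroʳ Y ⟨
    Y ℤ.* ℤ.0ℤ
      ≡⟨ cong (Y ℤ.*_) (term-vanishes (suc n) (suc k) n+1<2k+2) ⟨
    Y ℤ.* term (suc n) (suc k) ∎
    where
    n+1<2k+2 : suc n < 2 * suc k
    n+1<2k+2 = subst (suc n <_) (sym (ℕ.*-suc 2 k)) (s<s (s≤s (ℕ.≮⇒≥ 2k≮n)))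

  -- This is `m-K-suc` multiplied by the powers of `X` and `Y`. The exponent `2 + n ∸ 2 * suc k` is
  -- that of `term n k`; `lower-power` adjusts the other summand.
  term-recurrence : ∀ n k → term (2 + n) (suc k)
                            ≡ Y ℤ.* term (suc n) (suc k) ℤ.+ + suc n ℤ.* X ℤ.* term n k
  term-recurrence n k = begin
    + m (suc k) (K (2 + n)) ℤ.* (X ℤ.* X ℤ.^ k) ℤ.* Y ℤ.^ (2 + n ∸ 2 * suc k)
      ≡⟨ cong₂ (λ c e → c ℤ.* (X ℤ.* X ℤ.^ k) ℤ.* Y ℤ.^ e) coefficient
           (cong (2 + n ∸_) (ℕ.*-suc 2 k)) ⟩
    (+ suc n ℤ.* + m k (K n) ℤ.+ + m (suc k) (K (suc n))) ℤ.* (X ℤ.* X ℤ.^ k) ℤ.* Y ℤ.^ (n ∸ 2 * k)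
      ≡⟨ identity (+ suc n) (+ m k (K n)) (+ m (suc k) (K (suc n))) X (X ℤ.^ k) (Y ℤ.^ (n ∸ 2 * k)) ⟩
    + m (suc k) (K (suc n)) ℤ.* (X ℤ.* X ℤ.^ k) ℤ.* Y ℤ.^ (n ∸ 2 * k) ℤ.+ + suc n ℤ.* X ℤ.* term n k
      ≡⟨ cong (ℤ._+ + suc n ℤ.* X ℤ.* term n k) (lower-power n k) ⟩
    Y ℤ.* term (suc n) (suc k) ℤ.+ + suc n ℤ.* X ℤ.* term n k ∎
    where
    coefficient : + m (suc k) (K (2 + n)) ≡ + suc n ℤ.* + m k (K n) ℤ.+ + m (suc k) (K (suc n))
    coefficient = begin
      + m (suc k) (K (2 + n))
        ≡⟨ cong +_ (m-K-suc n k) ⟩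
      + (suc n * m k (K n) + m (suc k) (K (suc n)))
        ≡⟨ ℤ.pos-+ (suc n * m k (K n)) _ ⟩
      + (suc n * m k (K n)) ℤ.+ + m (suc k) (K (suc n))
        ≡⟨ cong (λ z → z ℤ.+ + m (suc k) (K (suc n))) (ℤ.pos-* (suc n) (m k (K n))) ⟩
      + suc n ℤ.* + m k (K n) ℤ.+ + m (suc k) (K (suc n)) ∎

    identity : ∀ c u v x y z → (c ℤ.* u ℤ.+ v) ℤ.* (x ℤ.* y) ℤ.* z
                               ≡ v ℤ.* (x ℤ.* y) ℤ.* z ℤ.+ c ℤ.* x ℤ.* (u ℤ.* y ℤ.* z)
    identity = solve-∀

  M̄-K-recurrence : ∀ n → M̄ (K (2 + n)) X Y
                         ≡ Y ℤ.* M̄ (K (suc n)) X Y ℤ.+ + suc n ℤ.* X ℤ.* M̄ (K n) X Y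
  M̄-K-recurrence n = begin
    -- `⌊ 2 + n /2⌋` is `suc h` by evaluation. The term at 0 is split off, so that index `suc k` for
    -- Kₙ₊₂ meets index `k` for Kₙ.
    term (2 + n) 0 ℤ.+ sum {suc h} (term (2 + n) ∘ suc ∘ toℕ)
      ≡⟨ cong₂ ℤ._+_ (term-0 (suc n)) (sum-cong-≗ {suc h} (term-recurrence n ∘ toℕ)) ⟩
    Y ℤ.* term (suc n) 0 ℤ.+ sum {suc h} (λ i → Y ℤ.* tail i ℤ.+ c ℤ.* terms i)
      ≡⟨ cong (λ z → Y ℤ.* term (suc n) 0 ℤ.+ z) (∑-distrib-+ (λ i → Y ℤ.* tail i) (λ i → c ℤ.* terms i)) ⟩
    Y ℤ.* term (suc n) 0 ℤ.+ (sum (λ i → Y ℤ.* tail i) ℤ.+ sum (λ i → c ℤ.* terms i))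
      ≡⟨ cong (λ z → Y ℤ.* term (suc n) 0 ℤ.+ z) (cong₂ ℤ._+_ (*-distribˡ-sum Y tail) (*-distribˡ-sum c terms)) ⟨
    Y ℤ.* term (suc n) 0 ℤ.+ (Y ℤ.* sum tail ℤ.+ c ℤ.* sum terms)
      ≡⟨ identity Y (term (suc n) 0) (sum tail) (c ℤ.* sum terms) ⟩
    Y ℤ.* (term (suc n) 0 ℤ.+ sum tail) ℤ.+ c ℤ.* sum terms
      ≡⟨ cong (λ M → Y ℤ.* M ℤ.+ c ℤ.* sum terms) (M̄-K-suc n) ⟨
    Y ℤ.* M̄ (K (suc n)) X Y ℤ.+ c ℤ.* M̄ (K n) X Y ∎
    where
    h = ⌊ n /2⌋
    c = + suc n ℤ.* X

    tail terms : Fin (suc h) → ℤ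
    tail  i = term (suc n) (suc (toℕ i))
    terms i = term n (toℕ i)

    identity : ∀ y t u v → y ℤ.* t ℤ.+ (y ℤ.* u ℤ.+ v) ≡ y ℤ.* (t ℤ.+ u) ℤ.+ v
    identity = solve-∀

-- Congruences of integers.

-- A record, so that x and y can be inferred from the type.
record _≈_[mod_] (x y : ℤ) (μ : ℕ) : Set where
  constructor mod
  field
    divisible : (+ μ) ℤ.∣ (x - y)

module _ {μ : ℕ} where

  ≈-refl : ∀ {x} → x ≈ x [mod μ ]
  ≈-refl {x} = mod (ℤ.divides ℤ.0ℤ (ℤ.+-inverseʳ x))

  +-cong-≈ : ∀ {x y z w} → x ≈ y [mod μ ] → z ≈ w [mod μ ] → (x ℤ.+ z) ≈ (y ℤ.+ w) [mod μ ]
  +-cong-≈ {x} {y} {z} {w} (mod μ∣x-y) (mod μ∣z-w) =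
    mod (subst ((+ μ) ℤ.∣_) (identity x y z w) (ℤ.∣m∣n⇒∣m+n μ∣x-y μ∣z-w))
    where
    identity : ∀ x y z w → (x - y) ℤ.+ (z - w) ≡ (x ℤ.+ z) - (y ℤ.+ w)
    identity = solve-∀

  *-cong-≈ : ∀ {x y z w} → x ≈ y [mod μ ] → z ≈ w [mod μ ] → (x ℤ.* z) ≈ (y ℤ.* w) [mod μ ]
  *-cong-≈ {x} {y} {z} {w} (mod μ∣x-y) (mod μ∣z-w) =
    mod (subst ((+ μ) ℤ.∣_) (identity x y z w) (ℤ.∣m∣n⇒∣m+n (ℤ.∣m⇒∣m*n z μ∣x-y) (ℤ.∣n⇒∣m*n y μ∣z-w)))
    where
    identity : ∀ x y z w → (x - y) ℤ.* z ℤ.+ y ℤ.* (z - w) ≡ x ℤ.* z - y ℤ.* w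
    identity = solve-∀

-- Ultimate periodicity by the pigeonhole principle.

module _ (μ : ℕ) .{{_ : NonZero μ}} where

  residue : ℤ → Fin μ
  residue x = fromℕ< (ℤ.n%ℕd<d x μ)

  residue-≡⇒≈ : ∀ x y → residue x ≡ residue y → x ≈ y [mod μ ]
  residue-≡⇒≈ x y eq = mod (ℤ.divides (x ℤ./ℕ μ - y ℤ./ℕ μ) (begin
    x - y
      ≡⟨ cong₂ _-_ (ℤ.a≡a%ℕn+[a/ℕn]*n x μ) (ℤ.a≡a%ℕn+[a/ℕn]*n y μ) ⟩
    (+ (x ℤ.%ℕ μ) ℤ.+ x ℤ./ℕ μ ℤ.* + μ) - (+ (y ℤ.%ℕ μ) ℤ.+ y ℤ./ℕ μ ℤ.* + μ)
      ≡⟨ cong (λ r → (+ r ℤ.+ x ℤ./ℕ μ ℤ.* + μ) - (+ (y ℤ.%ℕ μ) ℤ.+ y ℤ./ℕ μ ℤ.* + μ))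
           (Fin.fromℕ<-injective _ _ (ℤ.n%ℕd<d x μ) (ℤ.n%ℕd<d y μ) eq) ⟩
    (+ (y ℤ.%ℕ μ) ℤ.+ x ℤ./ℕ μ ℤ.* + μ) - (+ (y ℤ.%ℕ μ) ℤ.+ y ℤ./ℕ μ ℤ.* + μ)
      ≡⟨ identity (+ (y ℤ.%ℕ μ)) (x ℤ./ℕ μ) (y ℤ./ℕ μ) (+ μ) ⟩
    (x ℤ./ℕ μ - y ℤ./ℕ μ) ℤ.* + μ ∎))
    where
    identity : ∀ r p q d → (r ℤ.+ p ℤ.* d) - (r ℤ.+ q ℤ.* d) ≡ (p - q) ℤ.* d
    identity = solve-∀

  -- The coefficient `suc n` varies with `n`, but modulo μ only through the residue of `n`, which is
  -- why the index belongs to the state.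
  recurrence⇒ultimatelyPeriodic : (s : ℕ → ℤ) (X Y : ℤ) →
    (∀ n → s (2 + n) ≡ Y ℤ.* s (suc n) ℤ.+ + suc n ℤ.* X ℤ.* s n) → UltimatelyPeriodicMod μ s
  recurrence⇒ultimatelyPeriodic s X Y rec =
    -- The indices 0 to μ³ give one state more than there are values.
    let i , j , i<j , same = Fin.pigeonhole ℕ.≤-refl (state ∘ toℕ) in
      -- The successor makes the threshold at least 1 even when `i` is 0; the period is the distance
      -- between the coinciding states.
      suc (toℕ i) , toℕ j ∸ toℕ i , s≤s z≤n , ℕ.m<n⇒0<n∸m i<j , λ n n>i →
      ℤ.∣⇒∣ᵤ (_≈_[mod_].divisible (subst₂ (λ x y → s x ≈ s y [mod μ ])
        (shift n (ℕ.<⇒≤ n>i) (ℕ.<⇒≤ i<j)) (ℕ.m∸n+n≡m (ℕ.<⇒≤ n>i))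
        -- Advancing the agreement of `j` and `i` by `n ∸ toℕ i` steps reaches `n` plus the period
        -- on one side and `n` on the other.
        (proj₁ (proj₂ (agree (toℕ j) (toℕ i) (state-≡⇒Agree (toℕ j) (toℕ i) (sym same)) (n ∸ toℕ i))))))
    where
    state : ℕ → Fin (μ * (μ * μ))
    state n = combine (residue (+ n)) (combine (residue (s n)) (residue (s (suc n))))

    Agree : ℕ → ℕ → Set
    Agree p q = (+ p) ≈ (+ q) [mod μ ] × s p ≈ s q [mod μ ] × s (suc p) ≈ s (suc q) [mod μ ]

    state-≡⇒Agree : ∀ p q → state p ≡ state q → Agree p q
    state-≡⇒Agree p q eq
      with eq₀ , eq′ ← Fin.combine-injective _ _ _ _ eq
      with eq₁ , eq₂ ← Fin.combine-injective _ _ _ _ eq′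
      = residue-≡⇒≈ _ _ eq₀ , residue-≡⇒≈ _ _ eq₁ , residue-≡⇒≈ _ _ eq₂

    Agree-suc : ∀ {p q} → Agree p q → Agree (suc p) (suc q)
    Agree-suc {p} {q} (p≈q , sp≈sq , sp+1≈sq+1) =
      p+1≈q+1 , sp+1≈sq+1 ,
      subst₂ (λ x y → x ≈ y [mod μ ]) (sym (rec p)) (sym (rec q))
        (+-cong-≈ (*-cong-≈ (≈-refl {x = Y}) sp+1≈sq+1)
                  (*-cong-≈ (*-cong-≈ p+1≈q+1 (≈-refl {x = X})) sp≈sq))
      where
      p+1≈q+1 : (+ suc p) ≈ (+ suc q) [mod μ ]
      -- `+ suc p` is definitionally `1ℤ ℤ.+ + p`.
      p+1≈q+1 = +-cong-≈ (≈-refl {x = ℤ.1ℤ}) p≈q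

    agree : ∀ p q → Agree p q → ∀ d → Agree (d + p) (d + q)
    agree p q pq zero    = pq
    agree p q pq (suc d) = Agree-suc (agree p q pq d)

    shift : ∀ n {i j} → i ≤ n → i ≤ j → n ∸ i + j ≡ n + (j ∸ i)
    shift n {i} {j} i≤n i≤j = begin
      n ∸ i + j             ≡⟨ cong (λ k → n ∸ i + k) (ℕ.m+[n∸m]≡n i≤j) ⟨
      n ∸ i + (i + (j ∸ i)) ≡⟨ ℕ.+-assoc (n ∸ i) i (j ∸ i) ⟨
      n ∸ i + i + (j ∸ i)   ≡⟨ cong (_+ (j ∸ i)) (ℕ.m∸n+n≡m i≤n) ⟩
      n + (j ∸ i)           ∎

theorem1p8 : ∀ (a b μ : ℕ) .{{_ : NonZero a}} .{{_ : NonZero b}} .{{_ : NonZero μ}} →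
    UltimatelyPeriodicMod μ (λ n → M̄ (K n) (+ a) (+ b))
theorem1p8 a b μ =
  recurrence⇒ultimatelyPeriodic μ (λ n → M̄ (K n) (+ a) (+ b)) (+ a) (+ b) (M̄-K-recurrence (+ a) (+ b))
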